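{- Consider an instance of the Replenishment Storage Problem with $n$ items, cycle lengths $k_1,\ldots,k_n$, reorder sizes $s_1,\ldots,s_n$, and joint cycle length $k$. Let $\epsilon'>0$, $\epsilon=\epsilon'/2$ and $T=\frac{\epsilon D}{kn}$, and let $\hat{\mathbf{x}}$ be an optimal solution of the problem (scaled-RSP) with scaling factor $T$. Then $\hat{\mathbf{x}}$ is a $(1+\epsilon')$-approximate solution for the Replenishment Storage Problem; that is, $\hat{\mathbf{x}}$ is a valid assignment and $V(\hat{\mathbf{x}})\le(1+\epsilon')V^*$.
   Context: An instance of the Replenishment Storage Problem consists of $n\ge1$ items; item $i$ has a positive integer cycle length $k_i$ and a positive integer reorder size $s_i$. Put $k=\mathrm{lcm}(k_1,\ldots,k_n)$ (joint cycle length) and $D=\sum_{i=1}^n \frac{s_i}{k_i}$. A valid assignment is an $n\times k$ binary matrix $\mathbf{x}=(x_{ij})$ with $\sum_{j=1}^{k_i}x_{ij}=1$ for $i=1,\ldots,n$ and $x_{ij}=x_{i,j-k_i}$ for $i=1,\ldots,n$, $j=k_i+1,\ldots,k$ ($x_{ij}=1$ iff item $i$ is ordered at time $j$). Inventory levels: schedules are extended periodically with period $k$. If $x_{ij}=1$, the inventory level of item $i$ at time $\ell\in\{1,\ldots,k\}$ is $\frac{k_i-r}{k_i}s_i$, where $r\in\{0,\ldots,k_i-1\}$ and $r\equiv\ell-j\pmod{k_i}$ (level $s_i$ at an order time, decreasing by $s_i/k_i$ per time unit). $V_\ell(\mathbf{x})$ is the sum over all items of the inventory levels at time $\ell$, $V(\mathbf{x})=\max_{\ell\in\{1,\ldots,k\}}V_\ell(\mathbf{x})$,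 and $V^*=\min_{\mathbf{x}\text{ valid}}V(\mathbf{x})$. Scaled problem: let $s'_i=\lfloor s_i/T\rfloor$, $D'=D/T$, $Q'_j(\mathbf{x})=\sum_{i=1}^n s'_i x_{ij}$ and $z'(\mathbf{x})=\sum_{j=1}^k(k-j+1)Q'_j(\mathbf{x})$. The problem (scaled-RSP) is to maximize $z'(\mathbf{x})$ over all valid assignments $\mathbf{x}$ satisfying $\sum_{j=1}^{\ell}Q'_j(\mathbf{x})\le \ell D'$ for $\ell=1,\ldots,k$. -}

module Defs where

open import Algebra.Bundles using (CommutativeRing)
import Algebra.Properties.Monoid.Mult as MonoidMult
import Algebra.Properties.Monoid.Sum as MonoidSum
open import Data.Bool.Base using (Bool; if_then_else_)
open import Data.Fin.Base using (Fin; zero; suc; toℕ; inject≤)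
open import Data.Fin.Properties using (toℕ<n)
open import Data.Integer.Base as ℤ using (ℤ; +_; -[1+_])
import Data.Integer.Properties as ℤ
import Data.List.Base as List
import Data.List.Extrema as Extrema
open import Data.Nat.Base as ℕ using (ℕ; suc; NonZero; _∸_; _%_; ≢-nonZero)
import Data.Nat.Properties as ℕ
open import Data.Nat.Divisibility using (_∣_; ∣⇒≤; ∣-trans; 0∣⇒≡0; m∣m*n; n∣m*n)
open import Data.Nat.LCM using (lcm; m∣lcm[m,n]; n∣lcm[m,n]; lcm-least)
open import Data.Product.Base using (Σ-syntax; _×_; _,_)
open import Data.Vec.Functional as Vector using (Vector)
open import Level using (_⊔_) renaming (suc to lsuc)
open import Relation.Binary.Bundles using (TotalOrder)
open import Relation.Binary.Core using (Rel)
import Relation.Binary.Construct.NonStrictToStrict as Strict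
open import Relation.Binary.PropositionalEquality.Core using (_≡_; subst)
open import Relation.Binary.Structures using (IsTotalOrder)
open import Relation.Nullary.Negation.Core using (¬_)

record OrderedField c ℓ₁ ℓ₂ : Set (lsuc (c ⊔ ℓ₁ ⊔ ℓ₂)) where
  field
    commutativeRing : CommutativeRing c ℓ₁

  open CommutativeRing commutativeRing public
  open MonoidMult +-monoid using () renaming (_×_ to _·_)

  infix  4 _≤_
  infix  8 _⁻¹

  field
    _≤_          : Rel Carrier ℓ₂
    isTotalOrder : IsTotalOrder _≈_ _≤_
    +-monoˡ-≤    : ∀ {x y} z → x ≤ y → x + z ≤ y + z
    *-nonNeg     : ∀ {x y} → 0# ≤ x → 0# ≤ y → 0# ≤ x * y

    -- The value of 0# ⁻¹ is unspecified.
    _⁻¹          : Carrier → Carrier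
    ⁻¹-cong      : ∀ {x y} → x ≈ y → x ⁻¹ ≈ y ⁻¹
    *-inverseʳ   : ∀ {x} → ¬ (x ≈ 0#) → x * x ⁻¹ ≈ 1#
    0≉1          : ¬ (0# ≈ 1#)

  totalOrder : TotalOrder c ℓ₁ ℓ₂
  totalOrder = record { isTotalOrder = isTotalOrder }

  open Strict _≈_ _≤_ public using (_<_)

  infixl 7 _/_

  _/_ : Carrier → Carrier → Carrier
  x / y = x * y ⁻¹

  fromℕ : ℕ → Carrier
  fromℕ m = m · 1#

  fromℤ : ℤ → Carrier
  fromℤ (+ m)    = fromℕ m
  fromℤ -[1+ m ] = - fromℕ (suc m)

-- An ordered field with integer parts is Archimedean. Classically ℝ is a model,
-- as is ℚ; this structure stands in for the reals, which agda-stdlib lacks.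

record OrderedFieldWithFloor c ℓ₁ ℓ₂ : Set (lsuc (c ⊔ ℓ₁ ⊔ ℓ₂)) where
  field
    orderedField : OrderedField c ℓ₁ ℓ₂

  open OrderedField orderedField public

  field
    ⌊_⌋     : Carrier → ℤ
    ⌊x⌋≤x   : ∀ x → fromℤ ⌊ x ⌋ ≤ x
    x<⌊x⌋+1 : ∀ x → x < fromℤ ⌊ x ⌋ + 1#

lcms : ∀ {n} → Vector ℕ n → ℕ
lcms = Vector.foldr lcm 1

∣lcms : ∀ {n} (m : Vector ℕ n) i → m i ∣ lcms m
∣lcms {suc n} m zero    = m∣lcm[m,n] (m zero) _
∣lcms {suc n} m (suc i) =
  ∣-trans (∣lcms (Vector.tail m) i) (n∣lcm[m,n] (m zero) (lcms (Vector.tail m)))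

lcm-nonZero : ∀ m n → .{{NonZero m}} → .{{NonZero n}} → NonZero (lcm m n)
lcm-nonZero m n = ≢-nonZero λ lcm≡0 →
  ℕ.≢-nonZero⁻¹ (m ℕ.* n) {{ℕ.m*n≢0 m n}}
    (0∣⇒≡0 (subst (_∣ m ℕ.* n) lcm≡0 (lcm-least {m} (m∣m*n n) (n∣m*n m))))

lcms-nonZero : ∀ {n} (m : Vector ℕ n) → (∀ i → NonZero (m i)) → NonZero (lcms m)
lcms-nonZero {ℕ.zero} m m≢0 = _
lcms-nonZero {suc n}  m m≢0 =
  lcm-nonZero (m zero) (lcms (Vector.tail m))
    {{m≢0 zero}} {{lcms-nonZero (Vector.tail m) (λ i → m≢0 (suc i))}}

record Instance : Set where
  field
    n       : ℕ
    n≢0     : NonZero n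
    cycle   : Fin n → ℕ
    cycle≢0 : ∀ i → NonZero (cycle i)
    size    : Fin n → ℕ
    size≢0  : ∀ i → NonZero (size i)

  k : ℕ
  k = lcms cycle

  k≢0 : NonZero k
  k≢0 = lcms-nonZero cycle cycle≢0

  cycle≤k : ∀ i → cycle i ℕ.≤ k
  cycle≤k i = ∣⇒≤ {{k≢0}} (∣lcms cycle i)

bit : Bool → ℕ
bit b = if b then 1 else 0

module Replenishment (I : Instance) where
  open Instance I public
  open MonoidSum ℕ.+-0-monoid using () renaming (sum to sumℕ)

  -- Column j : Fin k stands for time suc (toℕ j), so times run over 1, …, k.
  Assignment : Set
  Assignment = Fin n → Fin k → Bool

  record Valid (x : Assignment) : Set where
    field
      one-order : ∀ i → sumℕ {cycle i} (λ j → bit (x i (inject≤ j (cycle≤k i)))) ≡ 1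
      periodic  : ∀ i (j j′ : Fin k) → toℕ j ≡ toℕ j′ ℕ.+ cycle i → x i j ≡ x i j′

  module _ {c ℓ₁ ℓ₂} (F : OrderedFieldWithFloor c ℓ₁ ℓ₂) where
    open OrderedFieldWithFloor F
    open MonoidSum +-monoid using () renaming (sum to sumF)
    open MonoidSum ℤ.+-0-monoid using () renaming (sum to sumℤ)

    D : Carrier
    D = sumF λ i → fromℕ (size i) / fromℕ (cycle i)

    -- Inventory level at time ℓ of item i when it is ordered at time j ≤ cycle i;
    -- adding cycle i avoids a negative difference in r ≡ ℓ - j (mod cycle i).
    levelFrom : (i : Fin n) (j ℓ : ℕ) → Carrier
    levelFrom i j ℓ = (fromℕ (cycle i ∸ r) / fromℕ (cycle i)) * fromℕ (size i)
      where
      r : ℕ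
      r = _%_ (ℓ ℕ.+ (cycle i ∸ j)) (cycle i) {{cycle≢0 i}}

    -- For valid x exactly one summand has x i j true: the one for the order time
    -- in 1, …, cycle i, which determines all the others modulo cycle i.
    level : Assignment → Fin n → ℕ → Carrier
    level x i ℓ = sumF {cycle i} λ j →
      if x i (inject≤ j (cycle≤k i)) then levelFrom i (suc (toℕ j)) ℓ else 0#

    inventory : Assignment → ℕ → Carrier
    inventory x ℓ = sumF λ i → level x i ℓ

    -- The first argument of max is its value on the empty list; as k ≥ 1, time 1
    -- already occurs in the list.
    peak : Assignment → Carrier
    peak x = Extrema.max totalOrder (inventory x 1)
      (List.tabulate {n = k} λ ℓ → inventory x (suc (toℕ ℓ)))

    record IsOptimalValue (v : Carrier) : Set (c ⊔ ℓ₁ ⊔ ℓ₂) where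
      field
        attained   : Σ[ x ∈ Assignment ] (Valid x × peak x ≈ v)
        lowerBound : ∀ x → Valid x → v ≤ peak x

    record IsApproximateSolution (ρ : Carrier) (x : Assignment) : Set (c ⊔ ℓ₁ ⊔ ℓ₂) where
      field
        valid : Valid x
        bound : ∀ v* → IsOptimalValue v* → peak x ≤ ρ * v*

    module Scaled (T : Carrier) where

      size′ : Fin n → ℤ
      size′ i = ⌊ fromℕ (size i) / T ⌋

      D′ : Carrier
      D′ = D / T

      Q′ : Assignment → Fin k → ℤ
      Q′ x j = sumℤ λ i → size′ i ℤ.* + bit (x i j)

      -- At time j = suc (toℕ j₀) the weight k - j + 1 is k ∸ toℕ j₀.
      z′ : Assignment → ℤ
      z′ x = sumℤ λ j → + (k ∸ toℕ j) ℤ.* Q′ x j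

      -- The sum ranges over the times 1, …, suc (toℕ ℓ).
      prefixQ′ : Assignment → Fin k → ℤ
      prefixQ′ x ℓ = sumℤ {suc (toℕ ℓ)} λ j → Q′ x (inject≤ j (toℕ<n ℓ))

      record Feasible (x : Assignment) : Set ℓ₂ where
        field
          valid       : Valid x
          constrained : ∀ ℓ → fromℤ (prefixQ′ x ℓ) ≤ fromℕ (suc (toℕ ℓ)) * D′

      record IsOptimal (x : Assignment) : Set ℓ₂ where
        field
          feasible : Feasible x
          maximal  : ∀ y → Feasible y → z′ y ℤ.≤ z′ x

{-# OPTIONS --safe #-}

-- Write a_i = s_i / k_i, and let N_i(ℓ) count the orders of item i up to time ℓ.
-- Unless item i is ordered its inventory drops by a_i per time unit, so
-- V_ℓ + ℓ D = V_0 + Σ s_i N_i(ℓ), with time 0 identified with time k; Abel summation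
-- turns this into z + k V_0 = const, z being the unscaled objective. Hence maximizing z
-- amounts to minimizing V_0.
-- Shift an optimal schedule so that its peak falls on time 0. Then Σ s_i N_i(ℓ) ≤ ℓ D,
-- so the shifted schedule is feasible for the scaled problem and x̂ scores at least as
-- well there. Rounding costs less than T per order. There are at most n k orders, so
-- it raises the peak of x̂ above V_0 by at most n k T = ε D; each weight is at most k,
-- so it raises k V_0 by at most n k² T, and V_0 by at most ε D. Finally D is at most
-- any inventory level, as every item always holds at least a_i.

module Submission where

open import Defs

import Algebra.Properties.AbelianGroup as AbelianGroupProperties
import Algebra.Properties.Group as GroupProperties
import Algebra.Properties.Ring as RingProperties
import Algebra.Properties.Semiring.Mult as SemiringMult
import Algebra.Properties.Semiring.Sum as SemiringSum
import Algebra.Solver.Ring.NaturalCoefficients.Default as NaturalSolver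
open import Data.Bool.Base using (Bool; true; false; if_then_else_)
open import Data.Fin.Base using (Fin; zero; suc; toℕ; inject≤; fromℕ<)
import Data.Fin.Properties as Fin
import Data.Integer.Properties as ℤ
import Data.List.Base as List
import Data.List.Extrema as Extrema
import Data.List.Membership.Propositional.Properties as List∈
import Data.List.Relation.Unary.All as All
import Data.List.Relation.Unary.All.Properties as All
open import Data.Nat.Base as ℕ using (ℕ; zero; suc; NonZero; _∸_; z≤n; s≤s)
open import Data.Nat.Divisibility using (_∣_; divides; ∣n⇒∣m*n)
open import Data.Nat.DivMod using (m≡m%n+[m/n]*n; [m+kn]%n≡m%n; m%n<n; m<n⇒m%n≡m; n%n≡0)
import Data.Nat.Properties as ℕ
open import Data.Nat.Solver using (module +-*-Solver)
open import Data.Product.Base using (∃; _×_; _,_; proj₁; proj₂)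
open import Data.Sum.Base using (inj₁; inj₂)
open import Function.Base using (_∘_)
open import Relation.Binary.Bundles using (TotalOrder)
open import Relation.Binary.PropositionalEquality as ≡ using (_≡_)
import Relation.Binary.Reasoning.PartialOrder as ≤-Reasoning
open import Relation.Nullary.Negation.Core using (¬_)

private
  module ℕΣ = SemiringSum ℕ.+-*-semiring
  module ℤΣ = SemiringSum ℤ.+-*-semiring

module PeriodicOrders where
  open import Data.Nat.Base
  open import Data.Nat.Properties
  open import Relation.Binary.PropositionalEquality
  open ℕΣ using (sum; sum-cong-≗; *-distribˡ-sum)

  -- Sums of bits and Boolean functions with a single true value.

  sum-mono : ∀ {m} {f g : Fin m → ℕ} → (∀ j → f j ≤ g j) → sum f ≤ sum g
  sum-mono {zero}  f≤g = z≤n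
  sum-mono {suc m} f≤g = +-mono-≤ (f≤g zero) (sum-mono (f≤g ∘ suc))

  bit≤1 : ∀ b → bit b ≤ 1
  bit≤1 true  = ≤-refl
  bit≤1 false = z≤n

  sum-bit≤ : ∀ {m} (f : Fin m → Bool) → sum (bit ∘ f) ≤ m
  sum-bit≤ {zero}  f = z≤n
  sum-bit≤ {suc m} f = +-mono-≤ (bit≤1 (f zero)) (sum-bit≤ (f ∘ suc))

  sum-bit≡0 : ∀ {m} (f : Fin m → Bool) → sum (bit ∘ f) ≡ 0 → ∀ j → f j ≡ false
  sum-bit≡0 {suc m} f eq j with f zero in f0
  sum-bit≡0 {suc m} f eq zero    | false = f0
  sum-bit≡0 {suc m} f eq (suc j) | false = sum-bit≡0 (f ∘ suc) eq j

  IsOnlyTrue : ∀ {m} → (Fin m → Bool) → Fin m → Set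
  IsOnlyTrue f j = f j ≡ true × (∀ i → f i ≡ true → i ≡ j)

  sum-bit≡1 : ∀ {m} (f : Fin m → Bool) → sum (bit ∘ f) ≡ 1 → ∃ (IsOnlyTrue f)
  sum-bit≡1 {suc m} f eq with f zero in f0
  ... | true = zero , f0 , only
    where
    only : ∀ i → f i ≡ true → i ≡ zero
    only zero    _  = refl
    only (suc i) fi with () ← trans (sym fi) (sum-bit≡0 (f ∘ suc) (suc-injective eq) i)
  ... | false with sum-bit≡1 (f ∘ suc) eq
  ... | j , fj , only = suc j , fj , only′
    where
    only′ : ∀ i → f i ≡ true → i ≡ suc j
    only′ zero    fi with () ← trans (sym f0) fi
    only′ (suc i) fi = cong suc (only i fi)

  -- The common position of the single `true` decides every value. This is how one cycle of a valid
  -- assignment gets compared with one cycle of a schedule.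
  onlyTrue-unique : ∀ {m} {f g : Fin m → Bool} {j} →
                    IsOnlyTrue f j → IsOnlyTrue g j → ∀ i → f i ≡ g i
  onlyTrue-unique {f = f} {g} (fj , f!) (gj , g!) i with f i in fi | g i in gi
  ... | true  | true  = refl
  ... | false | false = refl
  ... | true  | false with refl ← f! i fi with () ← trans (sym gi) gj
  ... | false | true  with refl ← g! i gi with () ← trans (sym fi) fj

  -- Sums over a sliding window of consecutive times.

  window : (ℕ → ℕ) → ℕ → ℕ → ℕ
  window f c L = sum {L} λ j → f (suc (toℕ j) + c)

  window-suc : ∀ f c L → window f c (suc L) ≡ f (suc c) + window f (suc c) L
  window-suc f c L =
    cong (f (suc c) +_) (sum-cong-≗ {L} λ j → cong (f ∘ suc) (sym (+-suc (toℕ j) c)))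

  -- Both sides sum `f` over the times `c + 1`, ..., `c + L + 1`; the left splits off the last time,
  -- the right the first.
  window-slide : ∀ f c L → window f c L + f (suc L + c) ≡ f (suc c) + window f (suc c) L
  window-slide f c zero    = sym (+-identityʳ _)
  window-slide f c (suc L) = begin
    window f c (suc L) + f (suc (suc L) + c)
      ≡⟨ cong₂ _+_ (window-suc f c L) (cong (f ∘ suc) (sym (+-suc L c))) ⟩
    f (suc c) + window f (suc c) L + f (suc L + suc c)
      ≡⟨ +-assoc (f (suc c)) _ _ ⟩
    f (suc c) + (window f (suc c) L + f (suc L + suc c))
      ≡⟨ cong (f (suc c) +_) (window-slide f (suc c) L) ⟩
    f (suc c) + (f (suc (suc c)) + window f (suc (suc c)) L)
      ≡⟨ cong (f (suc c) +_) (window-suc f (suc c) L) ⟨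
    f (suc c) + window f (suc c) (suc L) ∎
    where open ≡-Reasoning

  -- Sliding a window of length `p` by one step trades `f (suc c)` for `f (p + suc c)`, which are
  -- equal.
  window-periodic : ∀ f p → (∀ m → f (p + m) ≡ f m) → ∀ c → window f c p ≡ window f 0 p
  window-periodic f p per zero    = refl
  window-periodic f p per (suc c) = begin
    window f (suc c) p ≡⟨ +-cancelˡ-≡ (f (suc c)) _ _ slide ⟩
    window f c p       ≡⟨ window-periodic f p per c ⟩
    window f 0 p       ∎
    where
    open ≡-Reasoning
    slide : f (suc c) + window f (suc c) p ≡ f (suc c) + window f c p
    slide = begin
      f (suc c) + window f (suc c) p ≡⟨ window-slide f c p ⟨
      window f c p + f (suc p + c)   ≡⟨ cong (λ m → window f c p + f m) (+-suc p c) ⟨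
      window f c p + f (p + suc c)   ≡⟨ cong (window f c p +_) (per (suc c)) ⟩
      window f c p + f (suc c)       ≡⟨ +-comm (window f c p) _ ⟩
      f (suc c) + window f c p       ∎

  -- A single item of cycle length `K`: stock, orders and weighted orders.

  module Cycle (K : ℕ) .{{_ : NonZero K}} where

    -- The inventory level in units of reorder size over cycle length, which keeps the bookkeeping
    -- in ℕ. The clock `m` is set so that orders fall on the multiples of `K`.
    stock : ℕ → ℕ
    stock m = K ∸ m % K

    restocked : ℕ → Bool
    restocked m = m % K ≡ᵇ 0

    -- The window starts after time `c`, so its summands are exactly the bits in the first `L`
    -- columns of a schedule of phase `c`.
    orders : ℕ → ℕ → ℕ
    orders = window (bit ∘ restocked)

    -- For `L` equal to the joint cycle length this is the coefficient of the item's size in the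
    -- objective, where column `j` has weight `k ∸ toℕ j`.
    weightedOrders : ℕ → ℕ → ℕ
    weightedOrders c L = sum {L} λ j → (L ∸ toℕ j) * bit (restocked (suc (toℕ j) + c))

    %-shift : ∀ {p} → K ∣ p → ∀ m → (p + m) % K ≡ m % K
    %-shift (divides q refl) m = trans (cong (_% K) (+-comm (q * K) m)) ([m+kn]%n≡m%n m q K)

    stock-shift : ∀ {p} → K ∣ p → ∀ m → stock (p + m) ≡ stock m
    stock-shift K∣p m = cong (K ∸_) (%-shift K∣p m)

    restocked-shift : ∀ {p} → K ∣ p → ∀ m → restocked (p + m) ≡ restocked m
    restocked-shift K∣p m = cong (_≡ᵇ 0) (%-shift K∣p m)

    1≤stock : ∀ m → 1 ≤ stock m
    1≤stock m = m<n⇒0<n∸m (m%n<n m K)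

    suc-% : ∀ m → suc m % K ≡ suc (m % K) % K
    suc-% m = begin
      suc m % K                          ≡⟨ cong (λ t → suc t % K) (m≡m%n+[m/n]*n m K) ⟩
      (suc (m % K) + m / K * K) % K      ≡⟨ [m+kn]%n≡m%n (suc (m % K)) (m / K) K ⟩
      suc (m % K) % K                    ∎
      where open ≡-Reasoning

    -- Demand removes one unit per time step and an order adds `K`. The loss stands as `suc` on the
    -- left to avoid truncated subtraction.
    stock-step : ∀ m → suc (stock (suc m)) ≡ stock m + K * bit (restocked (suc m))
    stock-step m with m≤n⇒m<n∨m≡n (m%n<n m K)
    ... | inj₁ r+1<K
      rewrite trans (suc-% m) (m<n⇒m%n≡m r+1<K) =
      trans (sym (+-∸-assoc 1 (<⇒≤ r+1<K))) (sym (trans (cong (stock m +_) (*-zeroʳ K)) (+-identityʳ _)))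
    -- The cycle wraps around: the stock was 1 and returns to `K`.
    ... | inj₂ r+1≡K
      rewrite trans (suc-% m) (trans (cong (_% K) r+1≡K) (n%n≡0 K)) = begin
      suc K              ≡⟨ cong suc (*-identityʳ K) ⟨
      suc (K * 1)        ≡⟨ cong (_+ K * 1) (trans (cong (_∸ m % K) (sym r+1≡K)) (m+n∸n≡m 1 (m % K))) ⟨
      stock m + K * 1    ∎
      where open ≡-Reasoning

    -- The balance of `stock-step`, accumulated over the `L` steps after time `c`.
    stock-orders : ∀ c L → stock (L + c) + L ≡ stock c + K * orders c L
    stock-orders c zero    = cong (stock c +_) (sym (*-zeroʳ K))
    stock-orders c (suc L) = begin
      stock (suc L + c) + suc L
        ≡⟨ cong (λ m → stock m + suc L) (+-suc L c) ⟨
      stock (L + suc c) + suc L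
        ≡⟨ +-suc _ L ⟩
      suc (stock (L + suc c) + L)
        ≡⟨ cong suc (stock-orders (suc c) L) ⟩
      suc (stock (suc c)) + K * orders (suc c) L
        ≡⟨ cong (_+ K * orders (suc c) L) (stock-step c) ⟩
      stock c + K * b + K * orders (suc c) L
        ≡⟨ +-assoc (stock c) _ _ ⟩
      stock c + (K * b + K * orders (suc c) L)
        ≡⟨ cong (stock c +_) (*-distribˡ-+ K b _) ⟨
      stock c + K * (b + orders (suc c) L)
        ≡⟨ cong (λ t → stock c + K * t) (window-suc (bit ∘ restocked) c L) ⟨
      stock c + K * orders c (suc L) ∎
      where
      open ≡-Reasoning
      b = bit (restocked (suc c))

    -- After `K` steps the stock is back where it began, so in `stock-orders` the demand `K` equals
    -- `K` times the number of orders.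
    orders-cycle : ∀ c → orders c K ≡ 1
    orders-cycle c = *-cancelˡ-≡ _ _ K (sym (trans (*-identityʳ K) (+-cancelˡ-≡ (stock c) _ _ K≡)))
      where
      K≡ : stock c + K ≡ stock c + K * orders c K
      K≡ = trans (cong (_+ K) (sym (stock-shift (divides 1 (sym (*-identityˡ K))) c))) (stock-orders c K)

    private
      -- The triangular number L(L+1)/2; what matters is that it does not depend on the phase.
      triangle : ℕ → ℕ
      triangle L = sum {L} λ j → L ∸ toℕ j

    weightedOrders-suc : ∀ c L → weightedOrders c (suc L) ≡
                         suc L * bit (restocked (suc c)) + weightedOrders (suc c) L
    weightedOrders-suc c L = cong (suc L * bit (restocked (suc c)) +_)
      (sum-cong-≗ {L} λ j → cong (λ m → (L ∸ toℕ j) * bit (restocked (suc m))) (sym (+-suc (toℕ j) c)))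

    -- Abel summation of stock-orders.
    weightedOrders-stock : ∀ c L → K * weightedOrders c L + L * stock c ≡
                           window stock c L + triangle L
    weightedOrders-stock c zero    = cong (_+ 0) (*-zeroʳ K)
    weightedOrders-stock c (suc L) = begin
      K * weightedOrders c (suc L) + suc L * stock c
        ≡⟨ cong (λ w → K * w + suc L * stock c) (weightedOrders-suc c L) ⟩
      K * (suc L * b + w′) + suc L * stock c
        ≡⟨ solve 5 (λ K l b w s → K :* (l :* b :+ w) :+ l :* s := l :* (s :+ K :* b) :+ K :* w)
             refl K (suc L) b w′ (stock c) ⟩
      suc L * (stock c + K * b) + K * w′
        ≡⟨ cong (λ s → suc L * s + K * w′) (stock-step c) ⟨
      suc L * suc (stock (suc c)) + K * w′
        ≡⟨ solve 4 (λ K l s w → (con 1 :+ l) :* (con 1 :+ s) :+ K :* w := K :* w :+ l :* s :+ (con 1 :+ l :+ s))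
             refl K L (stock (suc c)) w′ ⟩
      K * w′ + L * stock (suc c) + (suc L + stock (suc c))
        ≡⟨ cong (_+ (suc L + stock (suc c))) (weightedOrders-stock (suc c) L) ⟩
      window stock (suc c) L + triangle L + (suc L + stock (suc c))
        ≡⟨ solve 4 (λ l s g t → g :+ t :+ (l :+ s) := s :+ g :+ (l :+ t))
             refl (suc L) (stock (suc c)) (window stock (suc c) L) (triangle L) ⟩
      stock (suc c) + window stock (suc c) L + triangle (suc L)
        ≡⟨ cong (_+ triangle (suc L)) (window-suc stock c L) ⟨
      window stock c (suc L) + triangle (suc L) ∎
      where
      open ≡-Reasoning
      open +-*-Solver
      b = bit (restocked (suc c))
      w′ = weightedOrders (suc c) L

    -- By `weightedOrders-stock` each side is the total stock over `p` consecutive times plus a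
    -- constant, and `p` is a period of the stock. This is the conservation law between objective
    -- and initial inventory, for one item.
    weightedOrders-invariant : ∀ {p} → K ∣ p → ∀ c c′ →
      K * weightedOrders c p + p * stock c ≡ K * weightedOrders c′ p + p * stock c′
    weightedOrders-invariant {p} K∣p c c′ = begin
      K * weightedOrders c p + p * stock c   ≡⟨ weightedOrders-stock c p ⟩
      window stock c p + triangle p          ≡⟨ cong (_+ triangle p) (per c) ⟩
      window stock 0 p + triangle p          ≡⟨ cong (_+ triangle p) (per c′) ⟨
      window stock c′ p + triangle p         ≡⟨ weightedOrders-stock c′ p ⟨
      K * weightedOrders c′ p + p * stock c′ ∎
      where
      open ≡-Reasoning
      per = window-periodic stock p (stock-shift K∣p)

    orders≤ : ∀ c L → orders c L ≤ L
    orders≤ c L = sum-bit≤ λ j → restocked (suc (toℕ j) + c)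

    -- There are at most `L` orders, each of weight at most `L`.
    weightedOrders≤ : ∀ c L → weightedOrders c L ≤ L * L
    weightedOrders≤ c L = begin
      weightedOrders c L
        ≤⟨ sum-mono {L} (λ j → *-monoˡ-≤ (bit (restocked (suc (toℕ j) + c))) (m∸n≤m L (toℕ j))) ⟩
      sum {L} (λ j → L * bit (restocked (suc (toℕ j) + c)))
        ≡⟨ *-distribˡ-sum {L} L (λ j → bit (restocked (suc (toℕ j) + c))) ⟨
      L * orders c L
        ≤⟨ *-monoʳ-≤ L (orders≤ c L) ⟩
      L * L ∎
      where open ℕ.≤-Reasoning

  -- Valid assignments correspond to one phase per item.

  module Phases (I : Instance) where
    open Replenishment I

    module Item (i : Fin n) = Cycle (cycle i) {{cycle≢0 i}}

    -- The phase `c i` is the clock of item `i` at time 0. Adding one constant to all phases shifts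
    -- the whole schedule in time.
    schedule : (Fin n → ℕ) → Assignment
    schedule c i j = Item.restocked i (suc (toℕ j) + c i)

    schedule-valid : ∀ c → Valid (schedule c)
    schedule-valid c = record
      { one-order = λ i → trans
          (sum-cong-≗ {cycle i} λ j → cong (λ m → bit (Item.restocked i (suc m + c i)))
            (Fin.toℕ-inject≤ j (cycle≤k i)))
          (Item.orders-cycle i (c i))
      ; periodic = λ i j j′ eq → begin
          Item.restocked i (suc (toℕ j) + c i)
            ≡⟨ cong (λ m → Item.restocked i (suc m + c i)) (trans eq (+-comm (toℕ j′) _)) ⟩
          Item.restocked i (suc (cycle i + toℕ j′) + c i)
            ≡⟨ cong (Item.restocked i) (trans (cong suc (+-assoc (cycle i) _ _)) (sym (+-suc (cycle i) _))) ⟩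
          Item.restocked i (cycle i + (suc (toℕ j′) + c i))
            ≡⟨ Item.restocked-shift i (divides 1 (sym (*-identityˡ _))) _ ⟩
          Item.restocked i (suc (toℕ j′) + c i) ∎
      }
      where open ≡-Reasoning

    module _ {x : Assignment} (x-valid : Valid x) where
      open Valid x-valid

      firstCycle : ∀ i → Fin (cycle i) → Bool
      firstCycle i j = x i (inject≤ j (cycle≤k i))

      firstOrder : ∀ i → ∃ (IsOnlyTrue (firstCycle i))
      firstOrder i = sum-bit≡1 (firstCycle i) (one-order i)

      -- Chosen so that the first order time plus the phase is `cycle i`. It is also the offset
      -- inside `levelFrom`, so the remainder there is literally the one in `stock`.
      phase : Fin n → ℕ
      phase i = cycle i ∸ suc (toℕ (proj₁ (firstOrder i)))

      -- Each side is true exactly once within the cycle, by validity and by `orders-cycle`; the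
      -- schedule is true at the order of `x`, so the two positions agree.
      firstCycle-schedule : ∀ i (j : Fin (cycle i)) →
                            firstCycle i j ≡ Item.restocked i (suc (toℕ j) + phase i)
      firstCycle-schedule i with firstOrder i
      ... | j₀ , only with sum-bit≡1 _ (Item.orders-cycle i (cycle i ∸ suc (toℕ j₀)))
      ... | j₁ , only₁ = onlyTrue-unique only (subst (IsOnlyTrue _) (sym (proj₂ only₁ j₀ true₀)) only₁)
        where
        true₀ : Item.restocked i (suc (toℕ j₀) + (cycle i ∸ suc (toℕ j₀))) ≡ true
        true₀ rewrite m+[n∸m]≡n (Fin.toℕ<n j₀) | n%n≡0 (cycle i) {{cycle≢0 i}} = refl

      periodic* : ∀ i q r (r<k : r < k) (s<k : q * cycle i + r < k) →
                  x i (fromℕ< s<k) ≡ x i (fromℕ< r<k)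
      periodic* i zero    r r<k s<k = cong (x i) (Fin.fromℕ<-cong _ _ refl _ _)
      periodic* i (suc q) r r<k s<k = trans
        (periodic i _ (fromℕ< s′<k) (begin
          toℕ (fromℕ< s<k)                 ≡⟨ Fin.toℕ-fromℕ< s<k ⟩
          cycle i + q * cycle i + r        ≡⟨ +-assoc (cycle i) _ _ ⟩
          cycle i + (q * cycle i + r)      ≡⟨ +-comm (cycle i) _ ⟩
          q * cycle i + r + cycle i        ≡⟨ cong (_+ cycle i) (Fin.toℕ-fromℕ< s′<k) ⟨
          toℕ (fromℕ< s′<k) + cycle i      ∎))
        (periodic* i q r r<k s′<k)
        where
        open ≡-Reasoning
        s′<k : q * cycle i + r < k
        s′<k = ≤-<-trans (+-monoˡ-≤ r (m≤n+m (q * cycle i) (cycle i))) s<k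

      -- Periodicity reduces the column modulo `cycle i`, on both sides, to the first cycle.
      schedule-phase : ∀ i j → x i j ≡ schedule phase i j
      schedule-phase i j = begin
        x i j
          ≡⟨ cong (x i) (Fin.toℕ-injective (trans toℕj≡ (sym (Fin.toℕ-fromℕ< s<k)))) ⟩
        x i (fromℕ< s<k)
          ≡⟨ periodic* i q r r<k s<k ⟩
        x i (fromℕ< r<k)
          ≡⟨ cong (x i) (Fin.toℕ-injective (trans (Fin.toℕ-fromℕ< r<k)
               (sym (trans (Fin.toℕ-inject≤ _ _) (Fin.toℕ-fromℕ< r<K))))) ⟩
        firstCycle i (fromℕ< r<K)
          ≡⟨ firstCycle-schedule i (fromℕ< r<K) ⟩
        Item.restocked i (suc (toℕ (fromℕ< r<K)) + phase i)
          ≡⟨ cong (λ m → Item.restocked i (suc m + phase i)) (Fin.toℕ-fromℕ< r<K) ⟩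
        Item.restocked i (suc r + phase i)
          ≡⟨ Item.restocked-shift i (divides q refl) _ ⟨
        Item.restocked i (q * cycle i + (suc r + phase i))
          ≡⟨ cong (Item.restocked i) (trans (+-suc _ _) (cong suc (sym (+-assoc (q * cycle i) r _)))) ⟩
        Item.restocked i (suc (q * cycle i + r) + phase i)
          ≡⟨ cong (λ m → Item.restocked i (suc m + phase i)) toℕj≡ ⟨
        schedule phase i j ∎
        where
        open ≡-Reasoning
        instance _ = cycle≢0 i
        r = toℕ j % cycle i
        q = toℕ j / cycle i
        r<K : r < cycle i
        r<K = m%n<n (toℕ j) (cycle i)
        r<k : r < k
        r<k = <-≤-trans r<K (cycle≤k i)
        toℕj≡ : toℕ j ≡ q * cycle i + r
        toℕj≡ = trans (m≡m%n+[m/n]*n (toℕ j) (cycle i)) (+-comm r _)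
        s<k : q * cycle i + r < k
        s<k = subst (_< k) toℕj≡ (Fin.toℕ<n j)

open PeriodicOrders
open import Data.Integer.Base as ℤ using (ℤ; +_; -[1+_]; _⊖_)

-- Exchanging sums over times and items in ℤ.

pos-sum : ∀ {m} (f : Fin m → ℕ) → ℤΣ.sum (λ j → + f j) ≡ + ℕΣ.sum f
pos-sum {zero}  f = ≡.refl
pos-sum {suc m} f = ≡.cong (λ t → + f zero ℤ.+ t) (pos-sum (f ∘ suc))

-- Brings `prefixQ′` into a form where each scaled size multiplies a natural number of orders.
sumℤ-swap : ∀ {m n} (s : Fin n → ℤ) (b : Fin n → Fin m → ℕ) →
            ℤΣ.sum (λ j → ℤΣ.sum λ i → s i ℤ.* + b i j) ≡ ℤΣ.sum (λ i → s i ℤ.* + ℕΣ.sum (b i))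
sumℤ-swap {m} {n} s b = begin
  ℤΣ.sum (λ j → ℤΣ.sum λ i → s i ℤ.* + b i j)   ≡⟨ ℤΣ.∑-comm (λ j i → s i ℤ.* + b i j) ⟩
  ℤΣ.sum (λ i → ℤΣ.sum λ j → s i ℤ.* + b i j)
    ≡⟨ ℤΣ.sum-cong-≗ {n} (λ i → ℤΣ.*-distribˡ-sum {m} (s i) (λ j → + b i j)) ⟨
  ℤΣ.sum (λ i → s i ℤ.* ℤΣ.sum λ j → + b i j)
    ≡⟨ ℤΣ.sum-cong-≗ {n} (λ i → ≡.cong (s i ℤ.*_) (pos-sum (b i))) ⟩
  ℤΣ.sum (λ i → s i ℤ.* + ℕΣ.sum (b i))         ∎
  where open ≡.≡-Reasoning

sumℤ-swap-weighted : ∀ {m n} (w : Fin m → ℕ) (s : Fin n → ℤ) (b : Fin n → Fin m → ℕ) →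
  ℤΣ.sum (λ j → + w j ℤ.* ℤΣ.sum λ i → s i ℤ.* + b i j) ≡
  ℤΣ.sum (λ i → s i ℤ.* + ℕΣ.sum λ j → w j ℕ.* b i j)
sumℤ-swap-weighted {m} {n} w s b = ≡.trans
  (ℤΣ.sum-cong-≗ {m} λ j → ≡.trans
    (ℤΣ.*-distribˡ-sum {n} (+ w j) (λ i → s i ℤ.* + b i j))
    (ℤΣ.sum-cong-≗ {n} λ i → assoc-pos (w j) (s i) (b i j)))
  (sumℤ-swap s λ i j → w j ℕ.* b i j)
  where
  assoc-pos : ∀ w s b → + w ℤ.* (s ℤ.* + b) ≡ s ℤ.* + (w ℕ.* b)
  assoc-pos w s b = begin
    + w ℤ.* (s ℤ.* + b)   ≡⟨ ℤ.*-assoc (+ w) s (+ b) ⟨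
    + w ℤ.* s ℤ.* + b     ≡⟨ ≡.cong (ℤ._* (+ b)) (ℤ.*-comm (+ w) s) ⟩
    s ℤ.* + w ℤ.* + b     ≡⟨ ℤ.*-assoc s (+ w) (+ b) ⟩
    s ℤ.* (+ w ℤ.* + b)   ≡⟨ ≡.cong (s ℤ.*_) (ℤ.pos-* w b) ⟨
    s ℤ.* + (w ℕ.* b)     ∎
    where open ≡.≡-Reasoning

-- Arithmetic in ordered fields, and the embeddings of ℕ and ℤ.

module OrderedFieldProperties {c ℓ₁ ℓ₂} (F : OrderedField c ℓ₁ ℓ₂) where
  open OrderedField F hiding (zero)
  open RingProperties ring using (-‿distribˡ-*; -‿distribʳ-*)
  open AbelianGroupProperties +-abelianGroup using () renaming (⁻¹-∙-comm to -‿+-comm)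
  open GroupProperties +-group using () renaming (⁻¹-involutive to -‿involutive)
  open SemiringMult semiring using (×-homo-+; ×1-homo-*; ×-assoc-*; ×-congʳ) renaming (_×_ to _·_)
  open NaturalSolver commutativeSemiring using (solve; _:=_; _:+_; _:*_; con)
  open SemiringSum semiring using
    (sum; sum-cong-≋; ∑-distrib-+; *-distribʳ-sum; sum-replicate; sum-replicate-zero)
  open TotalOrder totalOrder public using (poset; total; antisym)
    renaming (refl to ≤-refl; trans to ≤-trans; reflexive to ≤-reflexive; ≤-respˡ-≈ to ≤-respˡ; ≤-respʳ-≈ to ≤-respʳ)
  open ≤-Reasoning poset

  +-mono-≤ : ∀ {x y u v} → x ≤ y → u ≤ v → x + u ≤ y + v
  +-mono-≤ {x} {y} {u} {v} x≤y u≤v = begin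
    x + u ≤⟨ +-monoˡ-≤ u x≤y ⟩
    y + u ≈⟨ +-comm y u ⟩
    u + y ≤⟨ +-monoˡ-≤ y u≤v ⟩
    v + y ≈⟨ +-comm v y ⟩
    y + v ∎

  +-monoʳ-≤ : ∀ {x y} z → x ≤ y → z + x ≤ z + y
  +-monoʳ-≤ z x≤y = +-mono-≤ ≤-refl x≤y

  x+y-y≈x : ∀ x y → x + y - y ≈ x
  x+y-y≈x x y = trans (+-assoc x y _) (trans (+-congˡ (-‿inverseʳ y)) (+-identityʳ x))

  +-cancelʳ-≤ : ∀ {x y} z → x + z ≤ y + z → x ≤ y
  +-cancelʳ-≤ {x} {y} z x+z≤y+z = begin
    x           ≈⟨ x+y-y≈x x z ⟨
    x + z - z   ≤⟨ +-monoˡ-≤ (- z) x+z≤y+z ⟩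
    y + z - z   ≈⟨ x+y-y≈x y z ⟩
    y           ∎

  +-cancelˡ-≤ : ∀ {x y} z → z + x ≤ z + y → x ≤ y
  +-cancelˡ-≤ {x} {y} z z+x≤z+y = +-cancelʳ-≤ z (begin
    x + z ≈⟨ +-comm x z ⟩
    z + x ≤⟨ z+x≤z+y ⟩
    z + y ≈⟨ +-comm z y ⟩
    y + z ∎)

  x≤y⇒0≤y-x : ∀ {x y} → x ≤ y → 0# ≤ y - x
  x≤y⇒0≤y-x {x} x≤y = ≤-respˡ (-‿inverseʳ x) (+-monoˡ-≤ (- x) x≤y)

  *-monoˡ-≤ : ∀ {x y z} → 0# ≤ z → x ≤ y → x * z ≤ y * z
  *-monoˡ-≤ {x} {y} {z} 0≤z x≤y = begin
    x * z                 ≈⟨ +-identityˡ _ ⟨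
    0# + x * z            ≤⟨ +-monoˡ-≤ (x * z) (*-nonNeg (x≤y⇒0≤y-x x≤y) 0≤z) ⟩
    (y - x) * z + x * z   ≈⟨ distribʳ z _ x ⟨
    (y - x + x) * z       ≈⟨ *-congʳ (trans (+-assoc y _ x) (trans (+-congˡ (-‿inverseˡ x)) (+-identityʳ y))) ⟩
    y * z                 ∎

  *-monoʳ-≤ : ∀ {x y z} → 0# ≤ z → x ≤ y → z * x ≤ z * y
  *-monoʳ-≤ {x} {y} {z} 0≤z x≤y = begin
    z * x ≈⟨ *-comm z x ⟩
    x * z ≤⟨ *-monoˡ-≤ 0≤z x≤y ⟩
    y * z ≈⟨ *-comm y z ⟩
    z * y ∎

  x*y/y≈x : ∀ x {y} → ¬ (y ≈ 0#) → x * y / y ≈ x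
  x*y/y≈x x y≉0 = trans (*-assoc x _ _) (trans (*-congˡ (*-inverseʳ y≉0)) (*-identityʳ x))

  x/y*y≈x : ∀ x {y} → ¬ (y ≈ 0#) → x / y * y ≈ x
  x/y*y≈x x {y} y≉0 = trans (solve 3 (λ x y z → x :* y :* z := x :* z :* y) refl x (y ⁻¹) y) (x*y/y≈x x y≉0)

  *-cancelʳ : ∀ {x y z} → ¬ (z ≈ 0#) → x * z ≈ y * z → x ≈ y
  *-cancelʳ {x} {y} z≉0 xz≈yz = trans (sym (x*y/y≈x x z≉0)) (trans (*-congʳ xz≈yz) (x*y/y≈x y z≉0))

  -- By totality only `y ≤ x` needs an argument; then the products are equal by antisymmetry, and
  -- `z` cancels.
  *-cancelʳ-≤ : ∀ {x y z} → 0# < z → x * z ≤ y * z → x ≤ y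
  *-cancelʳ-≤ {x} {y} {z} (0≤z , 0≉z) xz≤yz with total x y
  ... | inj₁ x≤y = x≤y
  ... | inj₂ y≤x = ≤-reflexive (*-cancelʳ (0≉z ∘ sym) (antisym xz≤yz (*-monoˡ-≤ 0≤z y≤x)))

  -- If `1# ≤ 0#`, then `- 1#` is nonnegative, and so is its square `1#`.
  0≤1 : 0# ≤ 1#
  0≤1 with total 0# 1#
  ... | inj₁ 0≤1 = 0≤1
  ... | inj₂ 1≤0 = ≤-respʳ square (*-nonNeg 0≤-1 0≤-1)
    where
    0≤-1 : 0# ≤ - 1#
    0≤-1 = ≤-respʳ (+-identityˡ _) (x≤y⇒0≤y-x 1≤0)
    square : - 1# * - 1# ≈ 1#
    square = trans (sym (-‿distribˡ-* 1# _)) (trans (-‿cong (*-identityˡ _)) (-‿involutive 1#))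

  0≤fromℕ : ∀ m → 0# ≤ fromℕ m
  0≤fromℕ zero    = ≤-refl
  0≤fromℕ (suc m) = ≤-respˡ (+-identityʳ 0#) (+-mono-≤ 0≤1 (0≤fromℕ m))

  0<fromℕ : ∀ m → .{{NonZero m}} → 0# < fromℕ m
  0<fromℕ (suc m) = 0≤fromℕ (suc m) , λ 0≈1+m → 0≉1 (antisym 0≤1 (begin
    1#             ≈⟨ +-identityʳ 1# ⟨
    1# + 0#        ≤⟨ +-monoʳ-≤ 1# (0≤fromℕ m) ⟩
    1# + fromℕ m   ≈⟨ 0≈1+m ⟨
    0#             ∎))

  *-pos : ∀ {x y} → 0# < x → 0# < y → 0# < x * y
  *-pos {x} {y} (0≤x , 0≉x) (0≤y , 0≉y) = *-nonNeg 0≤x 0≤y ,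
    λ 0≈xy → 0≉x (*-cancelʳ (0≉y ∘ sym) (trans (zeroˡ y) 0≈xy))

  ⁻¹-pos : ∀ {x} → 0# < x → 0# < x ⁻¹
  ⁻¹-pos {x} (0≤x , 0≉x) = *-cancelʳ-≤ (0≤x , 0≉x) (begin
      0# * x    ≈⟨ zeroˡ x ⟩
      0#        ≤⟨ 0≤1 ⟩
      1#        ≈⟨ x⁻¹x≈1 ⟨
      x ⁻¹ * x  ∎) ,
    λ 0≈x⁻¹ → 0≉1 (trans (sym (zeroˡ x)) (trans (*-congʳ 0≈x⁻¹) x⁻¹x≈1))
    where
    x⁻¹x≈1 : x ⁻¹ * x ≈ 1#
    x⁻¹x≈1 = trans (*-comm _ x) (*-inverseʳ (0≉x ∘ sym))

  /-pos : ∀ {x y} → 0# < x → 0# < y → 0# < x / y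
  /-pos 0<x 0<y = *-pos 0<x (⁻¹-pos 0<y)

  fromℕ-+ : ∀ m n → fromℕ (m ℕ.+ n) ≈ fromℕ m + fromℕ n
  fromℕ-+ = ×-homo-+ 1#

  fromℕ-* : ∀ m n → fromℕ (m ℕ.* n) ≈ fromℕ m * fromℕ n
  fromℕ-* = ×1-homo-*

  fromℕ-mono : ∀ {m n} → m ℕ.≤ n → fromℕ m ≤ fromℕ n
  fromℕ-mono {n = n} z≤n = 0≤fromℕ n
  fromℕ-mono (s≤s m≤n) = +-monoʳ-≤ 1# (fromℕ-mono m≤n)

  -- Adding `fromℕ n` on the left keeps subtraction out of the induction, which lowers both
  -- arguments together.
  fromℤ-⊖ : ∀ m n → fromℤ (m ⊖ n) + fromℕ n ≈ fromℕ m
  fromℤ-⊖ m       zero    = +-identityʳ _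
  fromℤ-⊖ zero    (suc n) = -‿inverseˡ _
  fromℤ-⊖ (suc m) (suc n) rewrite ℤ.[1+m]⊖[1+n]≡m⊖n m n = trans
    (solve 2 (λ x y → x :+ (con 1 :+ y) := con 1 :+ (x :+ y)) refl (fromℤ (m ⊖ n)) (fromℕ n))
    (+-congˡ (fromℤ-⊖ m n))

  fromℤ-⊖′ : ∀ m n → fromℤ (m ⊖ n) ≈ fromℕ m - fromℕ n
  fromℤ-⊖′ m n = trans (sym (x+y-y≈x _ (fromℕ n))) (+-congʳ (fromℤ-⊖ m n))

  fromℤ-+ : ∀ i j → fromℤ (i ℤ.+ j) ≈ fromℤ i + fromℤ j
  fromℤ-+ (+ m)    (+ n)    = fromℕ-+ m n
  fromℤ-+ (+ m)    -[1+ n ] = fromℤ-⊖′ m (suc n)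
  fromℤ-+ -[1+ m ] (+ n)    = trans (fromℤ-⊖′ n (suc m)) (+-comm _ _)
  fromℤ-+ -[1+ m ] -[1+ n ] = trans
    (-‿cong (trans (reflexive (≡.cong (λ t → fromℕ (suc t)) (≡.sym (ℕ.+-suc m n)))) (fromℕ-+ (suc m) (suc n))))
    (sym (-‿+-comm _ _))

  fromℤ-*-pos : ∀ i m → fromℤ (i ℤ.* + m) ≈ fromℤ i * fromℕ m
  fromℤ-*-pos i zero    = trans (reflexive (≡.cong fromℤ (ℤ.*-zeroʳ i))) (sym (zeroʳ _))
  fromℤ-*-pos i (suc m) = trans (reflexive (≡.cong fromℤ (ℤ.*-suc i (+ m))))
    (trans (fromℤ-+ i _) (trans (+-cong (sym (*-identityʳ _)) (fromℤ-*-pos i m)) (sym (distribˡ _ _ _))))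

  fromℤ-mono : ∀ {i j} → i ℤ.≤ j → fromℤ i ≤ fromℤ j
  fromℤ-mono {i} {j} i≤j = begin
    fromℤ i                           ≈⟨ +-identityʳ _ ⟨
    fromℤ i + 0#                      ≤⟨ +-monoʳ-≤ _ (0≤fromℕ ℤ.∣ j ℤ.- i ∣) ⟩
    fromℤ i + fromℕ ℤ.∣ j ℤ.- i ∣     ≈⟨ fromℤ-+ i (+ ℤ.∣ j ℤ.- i ∣) ⟨
    fromℤ (i ℤ.+ + ℤ.∣ j ℤ.- i ∣)     ≡⟨ ≡.cong (λ t → fromℤ (i ℤ.+ t)) (ℤ.0≤i⇒+∣i∣≡i (ℤ.i≤j⇒0≤j-i i≤j)) ⟩
    fromℤ (i ℤ.+ (j ℤ.- i))           ≡⟨ ≡.cong fromℤ eq ⟩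
    fromℤ j                           ∎
    where
    eq : i ℤ.+ (j ℤ.- i) ≡ j
    eq = ≡.trans (ℤ.+-comm i _) (≡.trans (ℤ.+-assoc j _ i)
          (≡.trans (≡.cong (λ t → j ℤ.+ t) (ℤ.+-inverseˡ i)) (ℤ.+-identityʳ j)))

  fromℤ-sum : ∀ {m} (f : Fin m → ℤ) → fromℤ (ℤΣ.sum f) ≈ sum (fromℤ ∘ f)
  fromℤ-sum {zero}  f = refl
  fromℤ-sum {suc m} f = trans (fromℤ-+ (f zero) _) (+-congˡ (fromℤ-sum (f ∘ suc)))

  sum-mono-≤ : ∀ {m} {f g : Fin m → Carrier} → (∀ i → f i ≤ g i) → sum f ≤ sum g
  sum-mono-≤ {zero}  f≤g = ≤-refl
  sum-mono-≤ {suc m} f≤g = +-mono-≤ (f≤g zero) (sum-mono-≤ (f≤g ∘ suc))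

  sum-pos : ∀ {m} .{{_ : NonZero m}} {f : Fin m → Carrier} → (∀ i → 0# < f i) → 0# < sum f
  sum-pos {suc m} {f} 0<f = ≤-trans (proj₁ (0<f zero)) f₀≤ ,
    λ 0≈ → proj₂ (0<f zero) (antisym (proj₁ (0<f zero)) (≤-respʳ (sym 0≈) f₀≤))
    where
    f₀≤ : f zero ≤ sum f
    f₀≤ = begin
      f zero                   ≈⟨ +-identityʳ _ ⟨
      f zero + 0#              ≈⟨ +-congˡ (sum-replicate-zero m) ⟨
      f zero + sum {m} (λ _ → 0#) ≤⟨ +-monoʳ-≤ _ (sum-mono-≤ (proj₁ ∘ 0<f ∘ suc)) ⟩
      sum f                    ∎

  -- Collapses the sum that defines `level` to the term of the one order time.
  sum-onlyTrue : ∀ {m} {f : Fin m → Bool} {j} (t : Fin m → Carrier) → IsOnlyTrue f j →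
                 sum (λ i → if f i then t i else 0#) ≈ t j
  sum-onlyTrue {suc m} {f} {zero} t (fj , f!) rewrite fj =
    trans (+-congˡ (trans (sum-cong-≋ {m} rest) (sum-replicate-zero m))) (+-identityʳ _)
    where
    rest : ∀ i → (if f (suc i) then t (suc i) else 0#) ≈ 0#
    rest i with f (suc i) in fi
    ... | false = refl
    ... | true with () ← f! (suc i) fi
  sum-onlyTrue {suc m} {f} {suc j} t (fj , f!) with f zero in f0
  ... | true with () ← f! zero f0
  ... | false = trans (+-identityˡ _) (sum-onlyTrue (t ∘ suc) (fj , λ i fi → Fin.suc-injective (f! (suc i) fi)))

  -- Pairing field-valued weights with natural-number counts.

  infix 8 _∙_

  -- Inventory, ordered amounts and objective all have this shape, so identities proved per item in
  -- ℕ carry over to them by linearity.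
  _∙_ : ∀ {m} → (Fin m → Carrier) → (Fin m → ℕ) → Carrier
  u ∙ f = sum λ i → u i * fromℕ (f i)

  module _ {m : ℕ} where

    ∙-+ : ∀ (u : Fin m → Carrier) f g → u ∙ (λ i → f i ℕ.+ g i) ≈ u ∙ f + u ∙ g
    ∙-+ u f g = trans
      (sum-cong-≋ {m} λ i → trans (*-congˡ (fromℕ-+ (f i) (g i))) (distribˡ _ _ _))
      (∑-distrib-+ {m} _ _)

    ∙-const : ∀ (u : Fin m → Carrier) p → u ∙ (λ _ → p) ≈ sum u * fromℕ p
    ∙-const u p = sym (*-distribʳ-sum {m} (fromℕ p) u)

    ∙-* : ∀ {u v : Fin m → Carrier} {p : Fin m → ℕ} → (∀ i → u i * fromℕ (p i) ≈ v i) →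
          ∀ f → u ∙ (λ i → p i ℕ.* f i) ≈ v ∙ f
    ∙-* {p = p} up≈v f = sum-cong-≋ {m} λ i → trans (*-congˡ (fromℕ-* (p i) (f i)))
      (trans (sym (*-assoc _ _ _)) (*-congʳ (up≈v i)))

    ∙-cong : ∀ (u : Fin m → Carrier) {f g} → (∀ i → f i ≡ g i) → u ∙ f ≈ u ∙ g
    ∙-cong u f≡g = sum-cong-≋ {m} λ i → *-congˡ (reflexive (≡.cong fromℕ (f≡g i)))

    ∙-monoˡ : ∀ {u v : Fin m → Carrier} f → (∀ i → u i ≤ v i) → u ∙ f ≤ v ∙ f
    ∙-monoˡ f u≤v = sum-mono-≤ {m} λ i → *-monoˡ-≤ (0≤fromℕ (f i)) (u≤v i)

    ∙-monoʳ : ∀ {u : Fin m → Carrier} {f g} → (∀ i → 0# ≤ u i) → (∀ i → f i ℕ.≤ g i) → u ∙ f ≤ u ∙ g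
    ∙-monoʳ 0≤u f≤g = sum-mono-≤ {m} λ i → *-monoʳ-≤ (0≤u i) (fromℕ-mono (f≤g i))

    ∙-scale : ∀ (u : Fin m → Carrier) t f → (λ i → u i * t) ∙ f ≈ u ∙ f * t
    ∙-scale u t f = trans
      (sum-cong-≋ {m} λ i → solve 3 (λ u t f → u :* t :* f := u :* f :* t) refl (u i) t (fromℕ (f i)))
      (sym (*-distribʳ-sum {m} t _))

    ∙-shift : ∀ (u : Fin m → Carrier) t f → (λ i → u i + t) ∙ f ≈ u ∙ f + (λ _ → t) ∙ f
    ∙-shift u t f = trans (sum-cong-≋ {m} λ i → distribʳ _ _ _) (∑-distrib-+ {m} _ _)

    -- The total rounding loss, for a loss of `t` per counted unit and `m` items with counts at most
    -- `p`.
    const-∙-≤ : ∀ {t} {f : Fin m → ℕ} {p} → 0# ≤ t → (∀ i → f i ℕ.≤ p) →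
                (λ _ → t) ∙ f ≤ fromℕ p * (fromℕ m * t)
    const-∙-≤ {t} {f} {p} 0≤t f≤p = begin
      (λ _ → t) ∙ f                 ≤⟨ ∙-monoʳ {u = λ _ → t} (λ _ → 0≤t) f≤p ⟩
      _∙_ {m} (λ _ → t) (λ _ → p)   ≈⟨ ∙-const (λ _ → t) p ⟩
      sum {m} (λ _ → t) * fromℕ p   ≈⟨ *-congʳ (sum-replicate m) ⟩
      (m · t) * fromℕ p             ≈⟨ *-congʳ (trans (×-congʳ m (sym (*-identityˡ t))) (sym (×-assoc-* m 1# t))) ⟩
      fromℕ m * t * fromℕ p         ≈⟨ *-comm _ _ ⟩
      fromℕ p * (fromℕ m * t)       ∎

    fromℤ-sum-*-pos : ∀ (s : Fin m → ℤ) f → fromℤ (ℤΣ.sum λ i → s i ℤ.* + f i) ≈ (fromℤ ∘ s) ∙ f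
    fromℤ-sum-*-pos s f = trans (fromℤ-sum {m} _) (sum-cong-≋ {m} λ i → fromℤ-*-pos (s i) (f i))

-- Inventory, orders and peak as functions of the phases.

module Approximation {ℓ₀ ℓ₁ ℓ₂} (F : OrderedFieldWithFloor ℓ₀ ℓ₁ ℓ₂) (I : Instance) where
  open OrderedFieldWithFloor F hiding (zero)
  open OrderedFieldProperties orderedField
  open Replenishment I
  open Phases I
  open SemiringSum semiring using (sum; sum-cong-≋)
  open NaturalSolver commutativeSemiring using (solve; _:=_; _:+_; _:*_; con)
  open ≤-Reasoning poset

  s a : Fin n → Carrier
  s i = fromℕ (size i)
  a i = s i / fromℕ (cycle i)

  0<cycle : ∀ i → 0# < fromℕ (cycle i)
  0<cycle i = 0<fromℕ (cycle i) {{cycle≢0 i}}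

  0<a : ∀ i → 0# < a i
  0<a i = /-pos (0<fromℕ (size i) {{size≢0 i}}) (0<cycle i)

  0<D : 0# < D F
  0<D = sum-pos {n} {{n≢0}} 0<a

  a*cycle≈s : ∀ i → a i * fromℕ (cycle i) ≈ s i
  a*cycle≈s i = x/y*y≈x (s i) (proj₂ (0<cycle i) ∘ sym)

  stocks : (Fin n → ℕ) → ℕ → Fin n → ℕ
  stocks c ℓ i = Item.stock i (ℓ ℕ.+ c i)

  -- Depending on phases instead of an assignment, it is available at time 0 and beyond time `k`.
  V : (Fin n → ℕ) → ℕ → Carrier
  V c ℓ = a ∙ stocks c ℓ

  ordersBy : (Fin n → ℕ) → ℕ → Fin n → ℕ
  ordersBy c L i = Item.orders i (c i) L

  weights : (Fin n → ℕ) → Fin n → ℕ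
  weights c i = Item.weightedOrders i (c i) k

  -- `stock-orders` weighted by `a` and summed over the items; `a i` times the cycle length is the
  -- reorder size.
  V-orders : ∀ c L → V c L + D F * fromℕ L ≈ V c 0 + s ∙ ordersBy c L
  V-orders c L = begin-equality
    V c L + D F * fromℕ L
      ≈⟨ +-congˡ (∙-const a L) ⟨
    V c L + a ∙ (λ _ → L)
      ≈⟨ ∙-+ a (stocks c L) (λ _ → L) ⟨
    a ∙ (λ i → stocks c L i ℕ.+ L)
      ≈⟨ ∙-cong a (λ i → Item.stock-orders i (c i) L) ⟩
    a ∙ (λ i → stocks c 0 i ℕ.+ cycle i ℕ.* ordersBy c L i)
      ≈⟨ ∙-+ a (stocks c 0) (λ i → cycle i ℕ.* ordersBy c L i) ⟩
    V c 0 + a ∙ (λ i → cycle i ℕ.* ordersBy c L i)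
      ≈⟨ +-congˡ (∙-* {p = cycle} a*cycle≈s (ordersBy c L)) ⟩
    V c 0 + s ∙ ordersBy c L ∎

  weights-V : ∀ c → a ∙ (λ i → cycle i ℕ.* weights c i ℕ.+ k ℕ.* stocks c 0 i) ≈
                    s ∙ weights c + fromℕ k * V c 0
  weights-V c = begin-equality
    a ∙ (λ i → cycle i ℕ.* weights c i ℕ.+ k ℕ.* stocks c 0 i)
      ≈⟨ ∙-+ a (λ i → cycle i ℕ.* weights c i) (λ i → k ℕ.* stocks c 0 i) ⟩
    a ∙ (λ i → cycle i ℕ.* weights c i) + a ∙ (λ i → k ℕ.* stocks c 0 i)
      ≈⟨ +-cong (∙-* {p = cycle} a*cycle≈s (weights c))
           (∙-* {p = λ _ → k} (λ _ → refl) (stocks c 0)) ⟩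
    s ∙ weights c + (λ i → a i * fromℕ k) ∙ stocks c 0
      ≈⟨ +-congˡ (trans (∙-scale a (fromℕ k) (stocks c 0)) (*-comm _ _)) ⟩
    s ∙ weights c + fromℕ k * V c 0 ∎

  -- The conservation law summed over the items: a larger unscaled objective means a smaller
  -- inventory at time 0. Every cycle length divides `k`, as the law for one item demands.
  weights-invariant : ∀ c c′ → s ∙ weights c + fromℕ k * V c 0 ≈ s ∙ weights c′ + fromℕ k * V c′ 0
  weights-invariant c c′ = trans (sym (weights-V c)) (trans
    (∙-cong a λ i → Item.weightedOrders-invariant i (∣lcms cycle i) (c i) (c′ i))
    (weights-V c′))

  V-shift : ∀ c q L → V c (q ℕ.* k ℕ.+ L) ≈ V c L
  V-shift c q L = ∙-cong a λ i → ≡.trans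
    (≡.cong (Item.stock i) (ℕ.+-assoc (q ℕ.* k) L (c i)))
    (Item.stock-shift i (∣n⇒∣m*n q (∣lcms cycle i)) (L ℕ.+ c i))

  D≤V : ∀ c L → D F ≤ V c L
  D≤V c L = begin
    D F               ≈⟨ trans (*-congˡ (+-identityʳ 1#)) (*-identityʳ (D F)) ⟨
    D F * fromℕ 1     ≈⟨ ∙-const a 1 ⟨
    a ∙ (λ _ → 1)     ≤⟨ ∙-monoʳ (proj₁ ∘ 0<a) (λ i → Item.1≤stock i (L ℕ.+ c i)) ⟩
    V c L             ∎

  peak-≤ : ∀ x {v} → (∀ ℓ → inventory F x (suc (toℕ {k} ℓ)) ≤ v) → peak F x ≤ v
  peak-≤ x {v} bound = Extrema.max≤v⁺ totalOrder
    -- The default value of the maximum must be bounded too; it is the inventory in column 0, which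
    -- exists since `k` is positive.
    (≡.subst (λ t → inventory F x (suc t) ≤ v) (Fin.toℕ-fromℕ< 0<k) (bound (fromℕ< 0<k)))
    (All.tabulate⁺ bound)
    where
    0<k : 0 ℕ.< k
    0<k = ℕ.>-nonZero⁻¹ k {{k≢0}}

  inventory≤peak : ∀ x ℓ → inventory F x (suc (toℕ {k} ℓ)) ≤ peak F x
  inventory≤peak x ℓ = All.lookup (Extrema.xs≤max totalOrder _ _) (List∈.∈-tabulate⁺ ℓ)

  peak-attained : ∀ x → ∃ λ ℓ → peak F x ≡ inventory F x (suc ℓ)
  peak-attained x with Extrema.argmax-sel totalOrder (λ t → t) (inventory F x 1)
                         (List.tabulate {n = k} λ ℓ → inventory F x (suc (toℕ ℓ)))
  -- The maximum may be the default value, which is the inventory at time 1.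
  ... | inj₁ eq = 0 , eq
  ... | inj₂ p with ℓ , eq ← List∈.∈-tabulate⁻ p = toℕ ℓ , eq

  module _ {x : Assignment} (x-valid : Valid x) where

    level-stock : ∀ i ℓ → level F x i ℓ ≈ a i * fromℕ (Item.stock i (ℓ ℕ.+ phase x-valid i))
    level-stock i ℓ = trans
      (sum-onlyTrue (λ j → levelFrom F i (suc (toℕ j)) ℓ) (proj₂ (firstOrder x-valid i)))
      (solve 3 (λ g k⁻¹ s → g :* k⁻¹ :* s := s :* k⁻¹ :* g) refl _ _ _)

    inventory≈V : ∀ ℓ → inventory F x ℓ ≈ V (phase x-valid) ℓ
    inventory≈V ℓ = sum-cong-≋ {n} λ i → level-stock i ℓ

    -- Every positive time is congruent modulo `k` to one in 1, ..., `k`. Reducing `m` and not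
    -- `suc m` lands in that range.
    V≤peak : ∀ m → V (phase x-valid) (suc m) ≤ peak F x
    V≤peak m = begin
      V c (suc m)                          ≡⟨ ≡.cong (V c) m≡ ⟩
      V c (m ℕ./ k ℕ.* k ℕ.+ suc (m ℕ.% k))    ≈⟨ V-shift c (m ℕ./ k) _ ⟩
      V c (suc (m ℕ.% k))                    ≡⟨ ≡.cong (V c ∘ suc) (Fin.toℕ-fromℕ< r<k) ⟨
      V c (suc (toℕ (fromℕ< r<k)))         ≈⟨ inventory≈V _ ⟨
      inventory F x (suc (toℕ (fromℕ< r<k))) ≤⟨ inventory≤peak x (fromℕ< r<k) ⟩
      peak F x                             ∎
      where
      instance _ = k≢0
      c = phase x-valid
      r<k : m ℕ.% k ℕ.< k
      r<k = m%n<n m k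
      m≡ : suc m ≡ m ℕ./ k ℕ.* k ℕ.+ suc (m ℕ.% k)
      m≡ = ≡.trans (≡.cong suc (≡.trans (m≡m%n+[m/n]*n m k) (ℕ.+-comm (m ℕ.% k) _)))
             (≡.sym (ℕ.+-suc _ _))

  -- Rounding, and the comparison of an optimal scaled solution with any valid assignment.

  module _ {T : Carrier} (0<T : 0# < T) where
    open Scaled F T

    σ : Fin n → Carrier
    σ i = fromℤ (size′ i)

    T≉0 : ¬ (T ≈ 0#)
    T≉0 = proj₂ 0<T ∘ sym

    σT≤s : ∀ i → σ i * T ≤ s i
    σT≤s i = ≤-respʳ (x/y*y≈x _ T≉0) (*-monoˡ-≤ (proj₁ 0<T) (⌊x⌋≤x _))

    s≤σT+T : ∀ i → s i ≤ σ i * T + T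
    s≤σT+T i = begin
      s i                  ≈⟨ x/y*y≈x _ T≉0 ⟨
      s i / T * T          ≤⟨ *-monoˡ-≤ (proj₁ 0<T) (proj₁ (x<⌊x⌋+1 _)) ⟩
      (σ i + 1#) * T       ≈⟨ trans (distribʳ T _ _) (+-congˡ (*-identityˡ T)) ⟩
      σ i * T + T          ∎

    scaled-≤ : ∀ f → σ ∙ f * T ≤ s ∙ f
    scaled-≤ f = ≤-respˡ (∙-scale σ T f) (∙-monoˡ f σT≤s)

    -- Rounding loses at most `T` per unit of count. The bound `p` becomes `k` for order counts and
    -- `k` squared for weighted counts.
    ≤-scaled : ∀ f {p} → (∀ i → f i ℕ.≤ p) → s ∙ f ≤ σ ∙ f * T + fromℕ p * (fromℕ n * T)
    ≤-scaled f {p} f≤p = begin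
      s ∙ f                                       ≤⟨ ∙-monoˡ f s≤σT+T ⟩
      (λ i → σ i * T + T) ∙ f                     ≈⟨ ∙-shift (λ i → σ i * T) T f ⟩
      (λ i → σ i * T) ∙ f + (λ _ → T) ∙ f         ≤⟨ +-mono-≤ (≤-reflexive (∙-scale σ T f)) (const-∙-≤ (proj₁ 0<T) f≤p) ⟩
      σ ∙ f * T + fromℕ p * (fromℕ n * T)         ∎

    D′T≈D : D′ * T ≈ D F
    D′T≈D = x/y*y≈x (D F) T≉0

    module _ {x : Assignment} {c : Fin n → ℕ} (x≡ : ∀ i j → x i j ≡ schedule c i j) where

      -- The pointwise hypothesis serves both `x̂` with its phases, through `schedule-phase`, and
      -- `schedule c` itself, by reflexivity.
      z′≈ : fromℤ (z′ x) ≈ σ ∙ weights c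
      z′≈ = begin-equality
        fromℤ (z′ x)
          ≡⟨ ≡.cong fromℤ (sumℤ-swap-weighted (λ j → k ∸ toℕ j) size′ (λ i j → bit (x i j))) ⟩
        fromℤ (ℤΣ.sum λ i → size′ i ℤ.* + ℕΣ.sum λ j → (k ∸ toℕ j) ℕ.* bit (x i j))
          ≈⟨ fromℤ-sum-*-pos size′ _ ⟩
        σ ∙ (λ i → ℕΣ.sum λ j → (k ∸ toℕ j) ℕ.* bit (x i j))
          ≈⟨ ∙-cong σ (λ i → ℕΣ.sum-cong-≗ {k} λ j → ≡.cong (λ b → (k ∸ toℕ j) ℕ.* bit b) (x≡ i j)) ⟩
        σ ∙ weights c ∎

      prefixQ′≈ : ∀ ℓ → fromℤ (prefixQ′ x ℓ) ≈ σ ∙ ordersBy c (suc (toℕ ℓ))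
      prefixQ′≈ ℓ = begin-equality
        fromℤ (prefixQ′ x ℓ)
          ≡⟨ ≡.cong fromℤ (sumℤ-swap size′ (λ i j → bit (x i (inj j)))) ⟩
        fromℤ (ℤΣ.sum λ i → size′ i ℤ.* + ℕΣ.sum λ j → bit (x i (inj j)))
          ≈⟨ fromℤ-sum-*-pos size′ _ ⟩
        σ ∙ (λ i → ℕΣ.sum λ j → bit (x i (inj j)))
          ≈⟨ ∙-cong σ (λ i → ℕΣ.sum-cong-≗ {suc (toℕ ℓ)} λ j → ≡.cong bit (≡.trans (x≡ i (inj j))
               (≡.cong (λ m → Item.restocked i (suc m ℕ.+ c i)) (Fin.toℕ-inject≤ j (Fin.toℕ<n ℓ))))) ⟩
        σ ∙ ordersBy c (suc (toℕ ℓ)) ∎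
        where
        inj : Fin (suc (toℕ ℓ)) → Fin k
        inj j = inject≤ j (Fin.toℕ<n ℓ)

    -- By `V-orders` the amount ordered up to `L` exceeds `L` times D by V at `L` minus V at 0,
    -- which is at most zero. Rounding sizes down preserves the constraint.
    schedule-feasible : ∀ c → (∀ L → V c L ≤ V c 0) → Feasible (schedule c)
    schedule-feasible c V≤V₀ = record
      { valid       = schedule-valid c
      ; constrained = λ ℓ → let L = suc (toℕ ℓ) in *-cancelʳ-≤ 0<T (begin
          fromℤ (prefixQ′ (schedule c) ℓ) * T
            ≈⟨ *-congʳ (prefixQ′≈ (λ _ _ → ≡.refl) ℓ) ⟩
          σ ∙ ordersBy c L * T
            ≤⟨ scaled-≤ (ordersBy c L) ⟩
          s ∙ ordersBy c L
            ≤⟨ +-cancelˡ-≤ (V c 0) (≤-respˡ (V-orders c L) (+-monoˡ-≤ _ (V≤V₀ L))) ⟩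
          D F * fromℕ L
            ≈⟨ trans (*-congʳ (sym D′T≈D)) (solve 3 (λ d t l → d :* t :* l := l :* d :* t) refl D′ T (fromℕ L)) ⟩
          fromℕ L * D′ * T ∎)
      }

    module _ {x̂ : Assignment} (x̂-optimal : IsOptimal x̂) where
      open IsOptimal x̂-optimal
      open Feasible feasible

      private
        ĉ : Fin n → ℕ
        ĉ = phase valid

        E : Carrier
        E = fromℕ k * (fromℕ n * T)

      -- The scaled constraint bounds the amount ordered by `L` times D, up to the rounding loss `E`
      -- for at most `k` orders per item; `V-orders` turns this into a bound on inventory.
      V≤V₀+E : ∀ ℓ → V ĉ (suc (toℕ {k} ℓ)) ≤ V ĉ 0 + E
      V≤V₀+E ℓ = +-cancelʳ-≤ (D F * fromℕ L) (begin
        V ĉ L + D F * fromℕ L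
          ≈⟨ V-orders ĉ L ⟩
        V ĉ 0 + s ∙ ordersBy ĉ L
          ≤⟨ +-monoʳ-≤ _ (≤-scaled (ordersBy ĉ L) λ i →
               ℕ.≤-trans (Item.orders≤ i (ĉ i) L) (Fin.toℕ<n ℓ)) ⟩
        V ĉ 0 + (σ ∙ ordersBy ĉ L * T + E)
          ≤⟨ +-monoʳ-≤ _ (+-monoˡ-≤ E (*-monoˡ-≤ (proj₁ 0<T)
               (≤-respˡ (prefixQ′≈ (schedule-phase valid) ℓ) (constrained ℓ)))) ⟩
        V ĉ 0 + (fromℕ L * D′ * T + E)
          ≈⟨ solve 5 (λ v l d t e → v :+ (l :* d :* t :+ e) := v :+ e :+ d :* t :* l)
               refl (V ĉ 0) (fromℕ L) D′ T E ⟩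
        V ĉ 0 + E + D′ * T * fromℕ L
          ≈⟨ +-congˡ (*-congʳ D′T≈D) ⟩
        V ĉ 0 + E + D F * fromℕ L ∎)
        where L = suc (toℕ ℓ)

      -- The schedule of `c` is feasible, so `x̂` has at least its scaled objective. The
      -- conservation law converts this into a bound on `k` times the inventory at time 0, with
      -- error `k` times `E`; then `k` cancels.
      V₀≤V₀+E : ∀ {c} → (∀ L → V c L ≤ V c 0) → V ĉ 0 ≤ V c 0 + E
      V₀≤V₀+E {c} V≤V₀ = *-cancelʳ-≤ (0<fromℕ k {{k≢0}}) (+-cancelˡ-≤ (s ∙ weights ĉ) (begin
        s ∙ weights ĉ + V ĉ 0 * fromℕ k
          ≈⟨ +-congˡ (*-comm _ _) ⟩
        s ∙ weights ĉ + fromℕ k * V ĉ 0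
          ≈⟨ weights-invariant ĉ c ⟩
        s ∙ weights c + fromℕ k * V c 0
          ≤⟨ +-monoˡ-≤ _ (≤-scaled (weights c) λ i → Item.weightedOrders≤ i (c i) k) ⟩
        σ ∙ weights c * T + fromℕ (k ℕ.* k) * (fromℕ n * T) + fromℕ k * V c 0
          ≤⟨ +-monoˡ-≤ _ (+-monoˡ-≤ _ (*-monoˡ-≤ (proj₁ 0<T) σw≤σŵ)) ⟩
        σ ∙ weights ĉ * T + fromℕ (k ℕ.* k) * (fromℕ n * T) + fromℕ k * V c 0
          -- Returning to the true sizes of `x̂` goes upwards, so no second error term appears.
          ≤⟨ +-monoˡ-≤ _ (+-monoˡ-≤ _ (scaled-≤ (weights ĉ))) ⟩
        s ∙ weights ĉ + fromℕ (k ℕ.* k) * (fromℕ n * T) + fromℕ k * V c 0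
          ≈⟨ +-congʳ (+-congˡ (*-congʳ (fromℕ-* k k))) ⟩
        s ∙ weights ĉ + fromℕ k * fromℕ k * (fromℕ n * T) + fromℕ k * V c 0
          ≈⟨ solve 4 (λ w k t v → w :+ k :* k :* t :+ k :* v := w :+ (v :+ k :* t) :* k)
               refl (s ∙ weights ĉ) (fromℕ k) (fromℕ n * T) (V c 0) ⟩
        s ∙ weights ĉ + (V c 0 + E) * fromℕ k ∎))
        where
        σw≤σŵ : σ ∙ weights c ≤ σ ∙ weights ĉ
        σw≤σŵ = begin
          σ ∙ weights c          ≈⟨ z′≈ (λ _ _ → ≡.refl) ⟨
          fromℤ (z′ (schedule c)) ≤⟨ fromℤ-mono (maximal (schedule c) (schedule-feasible c V≤V₀)) ⟩
          fromℤ (z′ x̂)           ≈⟨ z′≈ (schedule-phase valid) ⟩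
          σ ∙ weights ĉ          ∎

      -- One `E` comes from the peak of `x̂` over its inventory at time 0, the other from comparing
      -- that inventory with the shifted `y`. The second component will make the additive error
      -- relative.
      peak-≤-2E : ∀ {y} → Valid y → peak F x̂ ≤ peak F y + (E + E) × D F ≤ peak F y
      peak-≤-2E {y} y-valid with ℓ , peak≡ ← peak-attained y = peak-≤ x̂ (λ j → begin
          inventory F x̂ (suc (toℕ j))   ≈⟨ inventory≈V valid _ ⟩
          V ĉ (suc (toℕ j))             ≤⟨ V≤V₀+E j ⟩
          V ĉ 0 + E                     ≤⟨ +-monoˡ-≤ E (V₀≤V₀+E {c°} V≤V₀) ⟩
          V c° 0 + E + E                ≈⟨ +-assoc _ E E ⟩
          V c° 0 + (E + E)              ≈⟨ +-congʳ V₀≈peak ⟩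
          peak F y + (E + E)            ∎) ,
        ≤-respʳ V₀≈peak (D≤V c° 0)
        where
        -- y shifted so that its peak falls on time 0.
        c° : Fin n → ℕ
        c° i = suc ℓ ℕ.+ phase y-valid i

        V₀≈peak : V c° 0 ≈ peak F y
        V₀≈peak = trans (sym (inventory≈V y-valid (suc ℓ))) (reflexive (≡.sym peak≡))

        V≤V₀ : ∀ L → V c° L ≤ V c° 0
        V≤V₀ L = begin
          V c° L
            -- Time `L` of the shifted schedule is time `suc (L + ℓ)` of `y`.
            ≈⟨ ∙-cong a (λ i → ≡.cong (Item.stock i) (≡.trans (≡.sym (ℕ.+-assoc L (suc ℓ) _))
                 (≡.cong (ℕ._+ phase y-valid i) (ℕ.+-suc L ℓ)))) ⟩
          V (phase y-valid) (suc (L ℕ.+ ℓ)) ≤⟨ V≤peak y-valid (L ℕ.+ ℓ) ⟩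
          peak F y                          ≈⟨ V₀≈peak ⟨
          V c° 0                            ∎

-- Choice of the scaling factor and conversion to a relative error.

theorem3p5 : ∀ {c ℓ₁ ℓ₂} (F : OrderedFieldWithFloor c ℓ₁ ℓ₂) (I : Instance) →
    let open OrderedFieldWithFloor F
        open Replenishment I in
    (ε′ : Carrier) → 0# < ε′ →
    let ε = ε′ / fromℕ 2
        T = (ε * D F) / (fromℕ k * fromℕ n) in
    (x̂ : Assignment) → Scaled.IsOptimal F T x̂ →
    IsApproximateSolution F (1# + ε′) x̂
theorem3p5 F I ε′ 0<ε′ x̂ x̂-optimal = record
  { valid = Scaled.Feasible.valid (Scaled.IsOptimal.feasible x̂-optimal)
  ; bound = bound
  }
  where
  open OrderedFieldWithFloor F hiding (zero)
  open OrderedFieldProperties orderedField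
  open Replenishment I
  open Approximation F I
  open NaturalSolver commutativeSemiring using (solve; _:=_; _:+_; _:*_; con)
  open ≤-Reasoning poset

  ε T : Carrier
  ε = ε′ / fromℕ 2
  T = (ε * D F) / (fromℕ k * fromℕ n)

  0<kn : 0# < fromℕ k * fromℕ n
  0<kn = *-pos (0<fromℕ k {{k≢0}}) (0<fromℕ n {{n≢0}})

  0<T : 0# < T
  0<T = /-pos (*-pos (/-pos 0<ε′ (0<fromℕ 2)) 0<D) 0<kn

  E : Carrier
  E = fromℕ k * (fromℕ n * T)

  2E≈ε′D : E + E ≈ ε′ * D F
  2E≈ε′D = begin-equality
    E + E
      -- The numeral spells out `fromℕ 2`, which unfolds to `1# + (1# + 0#)`. The factor `k * n` is
      -- gathered to cancel the denominator of `T`.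
      ≈⟨ solve 3 (λ k n t → k :* (n :* t) :+ k :* (n :* t) := (con 1 :+ (con 1 :+ con 0)) :* (t :* (k :* n)))
           refl (fromℕ k) (fromℕ n) T ⟩
    fromℕ 2 * (T * (fromℕ k * fromℕ n))
      ≈⟨ *-congˡ (x/y*y≈x (ε * D F) (proj₂ 0<kn ∘ sym)) ⟩
    fromℕ 2 * (ε * D F)
      ≈⟨ solve 3 (λ t e d → t :* (e :* d) := e :* t :* d) refl (fromℕ 2) ε (D F) ⟩
    ε * fromℕ 2 * D F
      ≈⟨ *-congʳ (x/y*y≈x ε′ (proj₂ (0<fromℕ 2) ∘ sym)) ⟩
    ε′ * D F ∎

  bound : ∀ v* → IsOptimalValue F v* → peak F x̂ ≤ (1# + ε′) * v*
  bound v* v*-optimal = begin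
    peak F x̂
      ≤⟨ proj₁ (peak-≤-2E 0<T x̂-optimal y-valid) ⟩
    peak F y + (E + E)
      ≈⟨ +-congˡ 2E≈ε′D ⟩
    peak F y + ε′ * D F
      -- D is at most the peak of `y`, so the error is at most `ε′` times the optimum.
      ≤⟨ +-monoʳ-≤ (peak F y) (*-monoʳ-≤ (proj₁ 0<ε′) (proj₂ (peak-≤-2E 0<T x̂-optimal y-valid))) ⟩
    peak F y + ε′ * peak F y
      ≈⟨ +-congʳ (*-identityˡ (peak F y)) ⟨
    1# * peak F y + ε′ * peak F y
      ≈⟨ distribʳ (peak F y) 1# ε′ ⟨
    (1# + ε′) * peak F y
      ≈⟨ *-congˡ (proj₂ (proj₂ (IsOptimalValue.attained v*-optimal))) ⟩
    (1# + ε′) * v* ∎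
    where
    y : Assignment
    y = proj₁ (IsOptimalValue.attained v*-optimal)
    y-valid : Valid y
    y-valid = proj₁ (proj₂ (IsOptimalValue.attained v*-optimal))
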